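{- Let $k$ and $\ell$ be positive integers and let $G$ be a graph of order $n$ with treewidth at most $k$. Then $$I_{\ell}(G) \geq \frac{M_{k,\ell}}{M_{k,\ell}+k+1}\, n .$$
   Context: All graphs are finite, simple and undirected; the order of a graph is its number of vertices. A tree decomposition of a graph $G$ is a pair $(T,(X_t)_{t\in V(T)})$, where $T$ is a tree and each bag $X_t$ is a subset of $V(G)$, such that (i) $\bigcup_{t} X_t=V(G)$; (ii) for each edge $uv$ of $G$ there is $t\in V(T)$ with $\{u,v\}\subseteq X_t$; (iii) for any $t,t''\in V(T)$, $X_t\cap X_{t''}\subseteq X_{t'}$ for every vertex $t'$ on the $tt''$-path of $T$. Its width is $\max_t |X_t|-1$, and the treewidth $tw(G)$ is the minimum width of a tree decomposition of $G$. A path decomposition is a tree decomposition in which $T$ is a path, and the pathwidth $pw(G)$ is the minimum width of a path decomposition of $G$. For a graph $G$ and a positive integer $\ell$, $I_{\ell}(G)$ is the maximum order of an induced subgraph of $G$ with pathwidth at most $\ell$. For positive integers $k,\ell$, $M_{k,\ell}$ is the maximum number $t$ such that every graph of order $t$ with treewidth at most $k$ has pathwidth at most $\ell$ (this is a finite number). -}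

module Defs where

open import Data.Fin.Base using (Fin; zero; suc; toℕ)
open import Data.Fin.Permutation using (Permutation′; _⟨$⟩ʳ_)
open import Data.Fin.Subset using (Subset; inside; outside; _∈_; _∩_; _⊆_; ∣_∣)
open import Data.Integer.Base as ℤ using (ℤ; +_; 1ℤ)
open import Data.List.Base using (List; []; _∷_; length)
import Data.List.Membership.Propositional as List
open import Data.List.Relation.Unary.Unique.Propositional using (Unique)
open import Data.Nat.Base as ℕ using (ℕ; suc; _⊔_; NonZero)
open import Data.Product.Base using (Σ-syntax; ∃-syntax; _×_)
open import Data.Sum.Base using (_⊎_)
open import Data.Vec.Base using ([]; _∷_)
import Data.Vec.Functional as Vector
open import Function.Bundles using (_⇔_)
open import Level using (0ℓ)
open import Relation.Binary.Construct.Closure.ReflexiveTransitive using (Star; ε; _◅_)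
open import Relation.Binary.Core using (Rel)
open import Relation.Binary.Definitions using (Symmetric; Irreflexive; Decidable)
open import Relation.Binary.PropositionalEquality using (_≡_; cong)
open import Relation.Nullary.Negation using (¬_)

IsMinimum : ∀ {a} → (ℤ → Set a) → ℤ → Set a
IsMinimum P x = P x × (∀ y → P y → x ℤ.≤ y)

IsMaximum : ∀ {a} → (ℕ → Set a) → ℕ → Set a
IsMaximum P x = P x × (∀ y → P y → y ℕ.≤ x)

record Graph (n : ℕ) : Set₁ where
  infix 4 _~_ _~?_
  field
    _~_    : Rel (Fin n) 0ℓ
    sym    : Symmetric _~_
    irrefl : Irreflexive _≡_ _~_
    _~?_   : Decidable _~_

-- The increasing enumeration of the elements of a subset.
embed : ∀ {n} (S : Subset n) → Fin ∣ S ∣ → Fin n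
embed (inside  ∷ S) zero    = zero
embed (inside  ∷ S) (suc i) = suc (embed S i)
embed (outside ∷ S) i       = suc (embed S i)

induced : ∀ {n} → Graph n → (S : Subset n) → Graph ∣ S ∣
induced G S = record
  { _~_    = λ i j → embed S i ~ embed S j
  ; sym    = sym
  ; irrefl = λ i≡j → irrefl (cong (embed S) i≡j)
  ; _~?_   = λ i j → embed S i ~? embed S j
  }
  where open Graph G

Consecutive : ∀ {n} → Rel (Fin n) 0ℓ
Consecutive i j = suc (toℕ i) ≡ toℕ j ⊎ suc (toℕ j) ≡ toℕ i

module _ {n} (G : Graph n) where
  open Graph G

  Walk : Rel (Fin n) 0ℓ
  Walk = Star _~_

  vertices : ∀ {u v} → Walk u v → List (Fin n)
  vertices {u} ε       = u ∷ []
  vertices {u} (_ ◅ p) = u ∷ vertices p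

  IsPath : ∀ {u v} → Walk u v → Set
  IsPath p = Unique (vertices p)

  Connected : Set
  Connected = ∀ u v → Walk u v

  -- A cycle is a path on at least three vertices whose ends are adjacent.
  Acyclic : Set
  Acyclic = ∀ {u v} (p : Walk u v) → IsPath p → 3 ℕ.≤ length (vertices p) → ¬ (v ~ u)

  record IsTree : Set where
    field
      nonEmpty  : NonZero n
      connected : Connected
      acyclic   : Acyclic

  IsPathGraph : Set
  IsPathGraph =
    Σ[ π ∈ Permutation′ n ] (∀ s t → s ~ t ⇔ Consecutive (π ⟨$⟩ʳ s) (π ⟨$⟩ʳ t))

record TreeDecomposition {n} (G : Graph n) : Set₁ where
  open Graph G using (_~_)
  field
    {order}     : ℕ
    tree        : Graph order
    isTree      : IsTree tree
    bag         : Fin order → Subset n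
    coverVertex : ∀ v → ∃[ t ] v ∈ bag t
    coverEdge   : ∀ {u v} → u ~ v → ∃[ t ] (u ∈ bag t × v ∈ bag t)
    coherent    : ∀ {t t″} (p : Walk tree t t″) → IsPath tree p →
                  ∀ {t′} → t′ List.∈ vertices tree p → bag t ∩ bag t″ ⊆ bag t′

  -- An integer, since the graph without vertices has a decomposition of width -1.
  width : ℤ
  width = + Vector.foldr _⊔_ 0 (λ t → ∣ bag t ∣) ℤ.- 1ℤ

open TreeDecomposition using (tree; width)

module _ {n} (G : Graph n) where

  IsTreewidth : ℤ → Set₁
  IsTreewidth = IsMinimum λ w → Σ[ D ∈ TreeDecomposition G ] width D ≡ w

  IsPathwidth : ℤ → Set₁
  IsPathwidth = IsMinimum λ w →
    Σ[ D ∈ TreeDecomposition G ] (IsPathGraph (tree D) × width D ≡ w)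

  TreewidthAtMost : ℕ → Set₁
  TreewidthAtMost k = ∃[ w ] (IsTreewidth w × w ℤ.≤ + k)

  PathwidthAtMost : ℕ → Set₁
  PathwidthAtMost ℓ = ∃[ w ] (IsPathwidth w × w ℤ.≤ + ℓ)

-- Maxima and minima are given as relations: IsI ℓ G i says that I_ℓ(G) = i,
-- and IsM k ℓ m says that M_{k,ℓ} = m.
IsI : ℕ → ∀ {n} → Graph n → ℕ → Set₁
IsI ℓ {n} G = IsMaximum λ i →
  Σ[ S ∈ Subset n ] (∣ S ∣ ≡ i × PathwidthAtMost (induced G S) ℓ)

IsM : ℕ → ℕ → ℕ → Set₁
IsM k ℓ = IsMaximum λ t →
  (H : Graph t) → TreewidthAtMost H k → PathwidthAtMost H ℓ

{-# OPTIONS --safe #-}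

-- Greedy processing of a tree decomposition from the leaves.  Every node t carries, besides
-- its bag X t, a set B t of vertices such that B t ─ X t induces a graph of pathwidth at most
-- ℓ.  Let c be a leaf with neighbour t and A = X c ∩ X t, which separates B c from the rest.
-- If |B c ─ A| ≤ M, then B c ─ X t has pathwidth at most ℓ by the choice of M, and B c is
-- merged into B t.  Otherwise there is W with B c ─ X c ⊆ W ⊆ B c ─ A, |W| ≥ M and pathwidth
-- at most ℓ: keep W and delete B c ─ W ⊆ X c, at most k + 1 vertices.  Thus at most k + 1
-- vertices are deleted for every M vertices kept.  The kept pieces have no edges between
-- them, so their path decompositions can be concatenated.
--
-- Minimal widths exist only up to double negation, which is harmless because the final
-- inequality is decidable.
module Submission where

open import Defs
open import Data.Empty renaming (⊥ to Empty)
open import Data.Fin.Base as Fin using (Fin; zero; suc; toℕ)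
open import Data.Fin.Permutation as Permutation using (_⟨$⟩ʳ_; _⟨$⟩ˡ_; inverseʳ; inverseˡ)
import Data.Fin.Properties as Fin
open import Data.Fin.Subset
  using (Subset; inside; outside; _∈_; _∉_; _⊆_; _∩_; _∪_; _─_; ⊥; ⊤; ⁅_⁆; ∣_∣)
open import Data.Fin.Subset.Properties
open import Data.Integer.Base as ℤ using (ℤ; +_; 1ℤ)
import Data.Integer.Properties as ℤ
open import Data.List.Base using (List; []; _∷_; _∷ʳ_; _++_; map; length; tabulate; allFin)
import Data.List.Membership.Propositional as List
open import Data.List.Membership.Propositional.Properties using (∈-map⁻; ∈-++⁻; ∈-allFin)
open import Data.List.Properties using (length-map)
open import Data.List.Relation.Unary.All as All using (All; []; _∷_)
import Data.List.Relation.Unary.All.Properties as All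
open import Data.List.Relation.Unary.Any as Any using (Any; here; there)
import Data.List.Relation.Unary.Any.Properties as Any
open import Data.List.Relation.Unary.Unique.Propositional using (Unique; []; _∷_)
import Data.List.Relation.Unary.Unique.Propositional.Properties as Unique
open import Data.Nat.Base as ℕ
  using (ℕ; zero; suc; _+_; _∸_; _⊔_; _*_; _≤_; _<_; z≤n; s≤s; NonZero)
open import Data.Nat.Induction using (<-rec)
import Data.Nat.Properties as ℕ
open import Data.Nat.Tactic.RingSolver using (solve-∀)
open import Data.Product.Base as Product using (Σ-syntax; ∃-syntax; _×_; _,_; proj₁; proj₂)
open import Data.Rational.Base as ℚ using (_/_; toℚᵘ)
import Data.Rational.Properties as ℚ
open import Data.Rational.Unnormalised.Base as ℚᵘ using (mkℚᵘ)
import Data.Rational.Unnormalised.Properties as ℚᵘ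
open import Data.Sum.Base as Sum using (_⊎_; inj₁; inj₂; [_,_]′)
open import Data.Vec.Base as Vec using ([]; _∷_; here; there)
import Data.Vec.Functional as Vector
import Data.Vec.Properties as Vec
open import Function.Base using (_∘_; id; case_of_)
open import Function.Bundles using (_⇔_; mk⇔; Equivalence)
open import Relation.Binary.Construct.Closure.ReflexiveTransitive as Star
  using (Star; ε; _◅_; _◅◅_; gmap)
open import Relation.Binary.PropositionalEquality
  using (_≡_; _≢_; refl; sym; trans; cong; subst; subst₂)
open import Relation.Nullary.Decidable
  using (Dec; yes; no; does; dec-true; decidable-stable; _×-dec_)
open import Relation.Nullary.Negation using (¬_; contradiction; ¬¬-map)

-- Paths, and attaching a leaf to a tree.

module _ {n} (G : Graph n) where

  source∈vertices : ∀ {u v} (p : Walk G u v) → u List.∈ vertices G p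
  source∈vertices ε       = here refl
  source∈vertices (_ ◅ _) = here refl

  target∈vertices : ∀ {u v} (p : Walk G u v) → v List.∈ vertices G p
  target∈vertices ε       = here refl
  target∈vertices (_ ◅ p) = there (target∈vertices p)

  closed-path : ∀ {u} (p : Walk G u u) → IsPath G p → vertices G p ≡ u ∷ []
  closed-path ε       _         = refl
  closed-path (_ ◅ p) (u∉p ∷ _) = contradiction refl (All.lookup u∉p (target∈vertices p))

++⁻ˡ-unique : ∀ {a} {A : Set a} (xs : List A) {ys} → Unique (xs ++ ys) → Unique xs
++⁻ˡ-unique []       _        = []
++⁻ˡ-unique (x ∷ xs) (x∉ ∷ !) = All.++⁻ˡ xs x∉ ∷ ++⁻ˡ-unique xs !

-- A tree decomposition without its covering conditions. No graph is involved, so bags can be pulled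
-- back or attached one at a time, and covering is checked only at the end.
record CoherentTree (n : ℕ) : Set₁ where
  field
    {order}  : ℕ
    tree     : Graph order
    isTree   : IsTree tree
    bag      : Fin order → Subset n
    coherent : ∀ {t t″} (p : Walk tree t t″) → IsPath tree p →
               ∀ {t′} → t′ List.∈ vertices tree p → bag t ∩ bag t″ ⊆ bag t′

module _ {m} (T : Graph m) (t₀ : Fin m) where
  private module T = Graph T

  LeafAdjacent : Fin (suc m) → Fin (suc m) → Set
  LeafAdjacent zero    zero    = Empty
  LeafAdjacent zero    (suc j) = j ≡ t₀
  LeafAdjacent (suc i) zero    = i ≡ t₀
  LeafAdjacent (suc i) (suc j) = i T.~ j

  addLeaf : Graph (suc m)
  addLeaf = record
    { _~_    = LeafAdjacent
    ; sym    = λ {i} {j} → symmetric i j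
    ; irrefl = λ {i} {j} → irreflexive i j
    ; _~?_   = decide
    }
    where
    symmetric : ∀ i j → LeafAdjacent i j → LeafAdjacent j i
    symmetric zero    (suc j) e = e
    symmetric (suc i) zero    e = e
    symmetric (suc i) (suc j) e = T.sym e

    irreflexive : ∀ i j → i ≡ j → ¬ LeafAdjacent i j
    irreflexive (suc i) (suc i) refl e = T.irrefl refl e

    decide : ∀ i j → Dec (LeafAdjacent i j)
    decide zero    zero    = no λ ()
    decide zero    (suc j) = j Fin.≟ t₀
    decide (suc i) zero    = i Fin.≟ t₀
    decide (suc i) (suc j) = i T.~? j

  -- The leaf has `t₀` as its only neighbour, so a walk between old nodes that visits the leaf
  -- repeats `t₀` and is no path.
  lower : ∀ {i j} (p : Walk addLeaf (suc i) (suc j)) → IsPath addLeaf p →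
          Σ[ q ∈ Walk T i j ] vertices addLeaf p ≡ map suc (vertices T q)
  lower ε _ = ε , refl
  lower (_◅_ {j = suc k} e p) (_ ∷ p!) =
    let q , p≡q = lower p p! in e ◅ q , cong (_ ∷_) p≡q
  lower (_◅_ {j = zero} refl (_◅_ {j = suc k} refl p)) ((_ ∷ i∉p) ∷ _) =
    contradiction refl (All.lookup i∉p (source∈vertices addLeaf p))

  lowerToLeaf : ∀ {i} (p : Walk addLeaf (suc i) zero) → IsPath addLeaf p →
                Σ[ q ∈ Walk T i t₀ ] vertices addLeaf p ≡ map suc (vertices T q) ∷ʳ zero
  lowerToLeaf (_◅_ {j = zero} refl p) (_ ∷ p!) =
    ε , cong (_ ∷_) (closed-path addLeaf p p!)
  lowerToLeaf (_◅_ {j = suc k} e p) (_ ∷ p!) =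
    let q , p≡q = lowerToLeaf p p! in e ◅ q , cong (_ ∷_) p≡q

  lower-isPath : ∀ {i j} {p : Walk addLeaf (suc i) (suc j)} (q : Walk T i j) →
                 IsPath addLeaf p → vertices addLeaf p ≡ map suc (vertices T q) → IsPath T q
  lower-isPath q p! p≡q = Unique.map⁻ (subst Unique p≡q p!)

  lowerToLeaf-isPath : ∀ {i} {p : Walk addLeaf (suc i) zero} (q : Walk T i t₀) →
                       IsPath addLeaf p → vertices addLeaf p ≡ map suc (vertices T q) ∷ʳ zero →
                       IsPath T q
  lowerToLeaf-isPath q p! p≡q = Unique.map⁻ (++⁻ˡ-unique _ (subst Unique p≡q p!))

  addLeaf-connected : Connected T → Connected addLeaf
  addLeaf-connected conn = connected
    where
    lift : ∀ i j → Walk addLeaf (suc i) (suc j)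
    lift i j = gmap suc id (conn i j)

    connected : Connected addLeaf
    connected zero    zero    = ε
    connected zero    (suc j) = refl ◅ lift t₀ j
    connected (suc i) zero    = lift i t₀ ◅◅ refl ◅ ε
    connected (suc i) (suc j) = lift i j

  -- If one end of the path is the leaf, the adjacent other end is `t₀`, and so is the neighbour of
  -- the leaf on the path; hence there are only two vertices. Otherwise the path lies in `T` by
  -- `lower`.
  addLeaf-acyclic : Acyclic T → Acyclic addLeaf
  addLeaf-acyclic acyc {suc i} {suc j} p p! 3≤p v~u =
    let q , p≡q = lower p p!
    in acyc q (lower-isPath q p! p≡q)
         (subst (3 ≤_) (trans (cong length p≡q) (length-map suc (vertices T q))) 3≤p) v~u
  addLeaf-acyclic acyc {zero} {suc .t₀} (_◅_ {j = suc .t₀} refl p) (_ ∷ p!) 3≤p refl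
    with vertices addLeaf p | closed-path addLeaf p p!
  addLeaf-acyclic acyc {zero} {suc .t₀} (_◅_ {j = suc .t₀} refl p) (_ ∷ p!) (s≤s (s≤s ())) refl
    | _ | refl
  addLeaf-acyclic acyc {suc .t₀} {zero} p p! 3≤p refl
    with q , p≡q ← lowerToLeaf p p!
    with s≤s (s≤s ()) ← subst (λ xs → 3 ≤ length xs)
      (trans p≡q (cong (λ xs → map suc xs ∷ʳ zero)
        (closed-path T q (lowerToLeaf-isPath q p! p≡q)))) 3≤p

  addLeaf-isTree : IsTree T → IsTree addLeaf
  addLeaf-isTree isTree = record
    { nonEmpty  = _
    ; connected = addLeaf-connected (IsTree.connected isTree)
    ; acyclic   = addLeaf-acyclic (IsTree.acyclic isTree)
    }

module _ {n} (C : CoherentTree n) where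
  open CoherentTree C

  -- A path between the leaf and an old node passes through `t₀`, so the hypothesis on `B` reduces
  -- coherence to that of `C`.
  addBag : (t₀ : Fin order) (B : Subset n) → (∀ s → B ∩ bag s ⊆ bag t₀) → CoherentTree n
  addBag t₀ B meet = record
    { tree = addLeaf tree t₀ ; isTree = addLeaf-isTree tree t₀ isTree
    ; bag = bag′ ; coherent = coherent′ }
    where
    bag′ : Fin (suc order) → Subset n
    bag′ zero    = B
    bag′ (suc t) = bag t

    T′ = addLeaf tree t₀

    coherent-suc : ∀ {i j} (p : Walk T′ (suc i) (suc j)) → IsPath T′ p →
                   ∀ {t′} → t′ List.∈ vertices T′ p → bag i ∩ bag j ⊆ bag′ t′
    coherent-suc p p! t′∈p u∈ =
      let q , p≡q = lower tree t₀ p p!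
          s , s∈q , t′≡s = ∈-map⁻ suc (subst (_ List.∈_) p≡q t′∈p)
      in subst (λ t → _ ∈ bag′ t) (sym t′≡s)
           (coherent q (lower-isPath tree t₀ q p! p≡q) s∈q u∈)

    coherent′ : ∀ {t t″} (p : Walk T′ t t″) → IsPath T′ p →
                ∀ {t′} → t′ List.∈ vertices T′ p → bag′ t ∩ bag′ t″ ⊆ bag′ t′
    coherent′ {suc i} {suc j} p p! t′∈p u∈ = coherent-suc p p! t′∈p u∈
    coherent′ {zero} {zero} p p! t′∈p u∈
      with here refl ← subst (_ List.∈_) (closed-path T′ p p!) t′∈p
      = proj₁ (x∈p∩q⁻ B B u∈)
    coherent′ {zero} {suc j} (_◅_ {j = suc .t₀} refl p) p! (here refl) u∈ =
      proj₁ (x∈p∩q⁻ B (bag j) u∈)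
    coherent′ {zero} {suc j} (_◅_ {j = suc .t₀} refl p) (_ ∷ p!) (there t′∈p) u∈ =
      coherent-suc p p! t′∈p (x∈p∩q⁺ (meet j u∈ , proj₂ (x∈p∩q⁻ B (bag j) u∈)))
    coherent′ {suc i} {zero} p p! t′∈p u∈
      with q , p≡q ← lowerToLeaf tree t₀ p p!
      with u∈i , u∈B ← x∈p∩q⁻ (bag i) B u∈
      with ∈-++⁻ (map suc (vertices tree q)) (subst (_ List.∈_) p≡q t′∈p)
    ... | inj₂ (here refl) = u∈B
    ... | inj₁ t′∈q with s , s∈q , refl ← ∈-map⁻ suc t′∈q =
      coherent q (lowerToLeaf-isPath tree t₀ q p! p≡q) s∈q
        (x∈p∩q⁺ (u∈i , meet i (x∈p∩q⁺ (u∈B , u∈i))))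

-- Subsets and partial injections between vertex sets.

module _ {n} {P : Fin n → Set} (P? : ∀ u → Dec (P u)) where

  comprehension : Subset n
  comprehension = Vec.tabulate (does ∘ P?)

  ∈-comprehension⁺ : ∀ {u} → P u → u ∈ comprehension
  ∈-comprehension⁺ {u} Pu = Vec.lookup⇒[]= u comprehension
    (trans (Vec.lookup∘tabulate (does ∘ P?) u) (dec-true (P? u) Pu))

  ∈-comprehension⁻ : ∀ {u} → u ∈ comprehension → P u
  ∈-comprehension⁻ {u} u∈ with P? u | trans (sym (Vec.lookup∘tabulate (does ∘ P?) u)) (Vec.[]=⇒lookup u∈)
  ... | yes Pu | _ = Pu

embed∈ : ∀ {n} (S : Subset n) i → embed S i ∈ S
embed∈ (inside  ∷ S) zero    = here
embed∈ (inside  ∷ S) (suc i) = there (embed∈ S i)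
embed∈ (outside ∷ S) i       = there (embed∈ S i)

embed-injective : ∀ {n} (S : Subset n) {i j} → embed S i ≡ embed S j → i ≡ j
embed-injective (inside  ∷ S) {zero}  {zero}  _  = refl
embed-injective (inside  ∷ S) {suc i} {suc j} eq = cong suc (embed-injective S (Fin.suc-injective eq))
embed-injective (outside ∷ S) eq = embed-injective S (Fin.suc-injective eq)

embed-surjective : ∀ {n} (S : Subset n) {u} → u ∈ S → ∃[ i ] embed S i ≡ u
embed-surjective (inside  ∷ S) here       = zero , refl
embed-surjective (inside  ∷ S) (there u∈) = let i , eq = embed-surjective S u∈ in suc i , cong suc eq
embed-surjective (outside ∷ S) (there u∈) = let i , eq = embed-surjective S u∈ in i , cong suc eq

-- A relation, so that one notion covers the inclusion of an induced subgraph, restriction to a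
-- subset, and padding by extra vertices, and so that it can be reversed by `flip`.
record PartialInjection (n m : ℕ) : Set₁ where
  infix 4 _↦_
  field
    _↦_        : Fin n → Fin m → Set
    _↦?_       : ∀ u i → Dec (u ↦ i)
    functional : ∀ {u i j} → u ↦ i → u ↦ j → i ≡ j
    injective  : ∀ {u v i} → u ↦ i → v ↦ i → u ≡ v

  mapsInto? : ∀ B u → Dec (∃[ i ] (u ↦ i × i ∈ B))
  mapsInto? B u = Fin.any? λ i → u ↦? i ×-dec i ∈? B

  preimage : Subset m → Subset n
  preimage B = comprehension (mapsInto? B)

  ∈-preimage⁺ : ∀ {u i B} → u ↦ i → i ∈ B → u ∈ preimage B
  ∈-preimage⁺ {B = B} u↦i i∈B = ∈-comprehension⁺ (mapsInto? B) (_ , u↦i , i∈B)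

  ∈-preimage⁻ : ∀ {u B} → u ∈ preimage B → ∃[ i ] (u ↦ i × i ∈ B)
  ∈-preimage⁻ {B = B} = ∈-comprehension⁻ (mapsInto? B)

  ∣preimage∣≤ : ∀ B → ∣ preimage B ∣ ≤ ∣ B ∣
  ∣preimage∣≤ B = Fin.injective⇒≤ {f = proj₁ ∘ image} image-injective
    where
    found : ∀ a → ∃[ i ] (embed (preimage B) a ↦ i × i ∈ B)
    found a = ∈-preimage⁻ (embed∈ (preimage B) a)

    image : ∀ a → ∃[ b ] embed B b ≡ proj₁ (found a)
    image a = embed-surjective B (proj₂ (proj₂ (found a)))

    embed-image : ∀ a → embed (preimage B) a ↦ embed B (proj₁ (image a))
    embed-image a = subst (embed (preimage B) a ↦_) (sym (proj₂ (image a))) (proj₁ (proj₂ (found a)))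

    image-injective : ∀ {a b} → proj₁ (image a) ≡ proj₁ (image b) → a ≡ b
    image-injective {a} {b} eq = embed-injective (preimage B)
      (injective (embed-image a)
        (subst (λ c → _ ↦ embed B c) (sym eq) (embed-image b)))

  preimageTree : CoherentTree m → CoherentTree n
  preimageTree C = record
    { tree = tree ; isTree = isTree ; bag = preimage ∘ bag ; coherent = coherent′ }
    where
    open CoherentTree C

    coherent′ : ∀ {t t″} (p : Walk tree t t″) → IsPath tree p → ∀ {t′} → t′ List.∈ vertices tree p →
                preimage (bag t) ∩ preimage (bag t″) ⊆ preimage (bag t′)
    coherent′ {t} {t″} p p! t′∈p u∈
      with u∈t , u∈t″ ← x∈p∩q⁻ (preimage (bag t)) (preimage (bag t″)) u∈
      with i , u↦i , i∈t ← ∈-preimage⁻ u∈t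
      with j , u↦j , j∈t″ ← ∈-preimage⁻ u∈t″
      with refl ← functional u↦i u↦j
      = ∈-preimage⁺ u↦i (coherent p p! t′∈p (x∈p∩q⁺ (i∈t , j∈t″)))

-- Path decompositions as lists of bags.

nextBag : ∀ {n} → List (Subset n) → Subset n
nextBag []      = ⊥
nextBag (B ∷ _) = B

-- The bags of a path decomposition, in order.
data Chain {n} : List (Subset n) → Set where
  []  : Chain []
  _∷_ : ∀ {B Bs} → (∀ {u} → u ∈ B → Any (u ∈_) Bs → u ∈ nextBag Bs) → Chain Bs → Chain (B ∷ Bs)

-- A path decomposition of width at most `ℓ` of the subgraph induced by `S`. The bags are subsets of
-- the whole vertex set, so restriction and union need no renumbering.
record PathBags (ℓ : ℕ) {n} (G : Graph n) (S : Subset n) : Set where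
  open Graph G using (_~_)
  field
    bags        : List (Subset n)
    chain       : Chain bags
    small       : All (λ B → ∣ B ∣ ≤ suc ℓ) bags
    within      : All (_⊆ S) bags
    coverVertex : ∀ {u} → u ∈ S → Any (u ∈_) bags
    coverEdge   : ∀ {u v} → u ∈ S → v ∈ S → u ~ v → Any (λ B → u ∈ B × v ∈ B) bags

module _ {n m} (ρ : PartialInjection n m) where
  open PartialInjection ρ

  any-preimage⁻ : ∀ {u Bs} → Any (u ∈_) (map preimage Bs) → ∃[ i ] (u ↦ i × Any (i ∈_) Bs)
  any-preimage⁻ u∈Bs = let B , B∈Bs , u∈ = List.find (Any.map⁻ u∈Bs)
                           i , u↦i , i∈ = ∈-preimage⁻ u∈
                       in i , u↦i , List.lose B∈Bs i∈

  preimageChain : ∀ {Bs} → Chain Bs → Chain (map preimage Bs)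
  preimageChain []                = []
  preimageChain (_∷_ {Bs = Bs} next c) = next′ Bs next ∷ preimageChain c
    where
    next′ : ∀ {B} Bs → (∀ {i} → i ∈ B → Any (i ∈_) Bs → i ∈ nextBag Bs) →
            ∀ {u} → u ∈ preimage B → Any (u ∈_) (map preimage Bs) →
            u ∈ nextBag (map preimage Bs)
    next′ (_ ∷ _) next u∈B u∈Bs
      with i , u↦i , i∈B  ← ∈-preimage⁻ u∈B
      with j , u↦j , j∈Bs ← any-preimage⁻ u∈Bs
      with refl ← functional u↦i u↦j
      = ∈-preimage⁺ u↦i (next i∈B j∈Bs)

  -- The domain of `ρ` is `S`, and each vertex of `S` occurs in the preimages exactly where its
  -- single image occurs.
  preimagePath : ∀ {ℓ} {G : Graph n} {H : Graph m} {S S′} → PathBags ℓ H S′ →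
                 (∀ {u i} → u ↦ i → u ∈ S) → (∀ {u} → u ∈ S → ∃[ i ] (u ↦ i × i ∈ S′)) →
                 (∀ {u v i j} → u ↦ i → v ↦ j → Graph._~_ G u v → Graph._~_ H i j) →
                 PathBags ℓ G S
  preimagePath path ↦⇒∈ ∈⇒↦ edge = record
    { bags        = map preimage bags
    ; chain       = preimageChain chain
    ; small       = All.map⁺ (All.map (ℕ.≤-trans (∣preimage∣≤ _)) small)
    ; within      = All.map⁺ (All.universal (λ B {u} u∈ → ↦⇒∈ (proj₁ (proj₂ (∈-preimage⁻ {u} {B} u∈)))) bags)
    ; coverVertex = λ u∈S → let i , u↦i , i∈ = ∈⇒↦ u∈S in
        Any.map⁺ (Any.map (∈-preimage⁺ u↦i) (coverVertex i∈))
    ; coverEdge   = λ u∈S v∈S u~v →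
        let i , u↦i , i∈ = ∈⇒↦ u∈S
            j , v↦j , j∈ = ∈⇒↦ v∈S
        in Any.map⁺ (Any.map (λ (i∈B , j∈B) → ∈-preimage⁺ u↦i i∈B , ∈-preimage⁺ v↦j j∈B)
             (coverEdge i∈ j∈ (edge u↦i v↦j u~v)))
    }
    where open PathBags path

flip : ∀ {n m} → PartialInjection n m → PartialInjection m n
flip ρ = record
  { _↦_ = λ i u → u ↦ i ; _↦?_ = λ i u → u ↦? i ; functional = injective ; injective = functional }
  where open PartialInjection ρ

-- Path-shaped trees from lists of bags.

point : ∀ {n} → CoherentTree n
point = record
  { tree = record { _~_ = λ _ _ → Empty ; sym = λ () ; irrefl = λ _ () ; _~?_ = λ _ _ → no λ () }
  ; isTree = record
    { nonEmpty = _
    ; connected = λ { zero zero → ε }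
    ; acyclic = λ { ε _ (s≤s ()) } }
  ; bag = λ (_ : Fin 1) → ⊥
  ; coherent = λ _ _ _ u∈ → contradiction (proj₁ (x∈p∩q⁻ ⊥ ⊥ u∈)) ∉⊥
  }

-- `end` is the node to which the next bag is attached. It is node 0 because `addLeaf` gives the new
-- leaf that number, so the numbering follows the path. For the empty list, the default of `nextBag`
-- is the empty bag of `point`.
record ChainTree {n} (Bs : List (Subset n)) : Set₁ where
  field
    C : CoherentTree n
  open CoherentTree C public
  field
    end         : Fin order
    end≡0       : toℕ end ≡ 0
    bag-end     : bag end ≡ nextBag Bs
    consecutive : ∀ s t → Graph._~_ tree s t ⇔ Consecutive s t
    bag-list    : ∀ t → bag t ≡ ⊥ ⊎ bag t List.∈ Bs
    list-bag    : ∀ {B} → B List.∈ Bs → ∃[ t ] bag t ≡ B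

-- The recursion starts from a node with an empty bag, so the tree has one node more than the
-- list has bags.
chainTree : ∀ {n} {Bs : List (Subset n)} → Chain Bs → ChainTree Bs
chainTree [] = record
  { C = point ; end = zero ; end≡0 = refl ; bag-end = refl
  ; consecutive = λ { zero zero → mk⇔ (λ ()) λ { (inj₁ ()) ; (inj₂ ()) } }
  ; bag-list = λ _ → inj₁ refl ; list-bag = λ () }
chainTree {n} {B ∷ Bs} (next ∷ chain) = record
  { C = addBag C end B meet ; end = zero ; end≡0 = refl ; bag-end = refl
  ; consecutive = consecutive′
  ; bag-list = λ { zero → inj₂ (here refl) ; (suc t) → Sum.map₂ there (bag-list t) }
  ; list-bag = λ { (here refl) → zero , refl ; (there B∈) → Product.map suc id (list-bag B∈) }
  }
  where
  open ChainTree (chainTree chain)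

  meet : ∀ s → B ∩ bag s ⊆ bag end
  meet s {u} u∈ with u∈B , u∈s ← x∈p∩q⁻ B (bag s) u∈ with bag-list s
  ... | inj₁ s≡⊥  = contradiction (subst (u ∈_) s≡⊥ u∈s) ∉⊥
  ... | inj₂ s∈Bs = subst (u ∈_) (sym bag-end) (next u∈B (List.lose s∈Bs u∈s))

  ≡end⇒ : ∀ {j} → j ≡ end → 1 ≡ suc (toℕ j)
  ≡end⇒ refl = cong suc (sym end≡0)

  ⇒≡end : ∀ {j} → 1 ≡ suc (toℕ j) → j ≡ end
  ⇒≡end eq = Fin.toℕ-injective (trans (sym (ℕ.suc-injective eq)) (sym end≡0))

  consecutive′ : ∀ s t → LeafAdjacent tree end s t ⇔ Consecutive s t
  consecutive′ zero    zero    = mk⇔ (λ ()) λ { (inj₁ ()) ; (inj₂ ()) }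
  consecutive′ zero    (suc j) = mk⇔ (inj₁ ∘ ≡end⇒) λ { (inj₁ eq) → ⇒≡end eq ; (inj₂ ()) }
  consecutive′ (suc i) zero    = mk⇔ (inj₂ ∘ ≡end⇒) λ { (inj₁ ()) ; (inj₂ eq) → ⇒≡end eq }
  consecutive′ (suc i) (suc j) = mk⇔
    (Sum.map (cong suc) (cong suc) ∘ Equivalence.to (consecutive i j))
    (Equivalence.from (consecutive i j) ∘ Sum.map ℕ.suc-injective ℕ.suc-injective)

-- Lists of bags from path graphs.

convex⇒chain : ∀ {n N} (f : Fin N → Subset n) →
               (∀ {u i j k} → toℕ i ≤ toℕ j → toℕ j ≤ toℕ k → u ∈ f i → u ∈ f k → u ∈ f j) →
               Chain (tabulate f)
convex⇒chain {N = zero}        f convex = []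
convex⇒chain {N = suc zero}    f convex = (λ _ ()) ∷ []
convex⇒chain {N = suc (suc N)} f convex =
  (λ u∈ u∈Bs → let k , u∈k = Any.tabulate⁻ {f = f ∘ suc} u∈Bs
                in convex {k = suc k} z≤n (s≤s z≤n) u∈ u∈k) ∷
  convex⇒chain (f ∘ suc) λ {_} {i} {j} {k} i≤j j≤k →
    convex {i = suc i} {suc j} {suc k} (s≤s i≤j) (s≤s j≤k)

module _ {N} (T : Graph N) (isPath : IsPathGraph T) where
  private
    π = proj₁ isPath
    module T = Graph T

  node : Fin N → Fin N
  node = π ⟨$⟩ˡ_

  next-edge : ∀ {i j} → suc (toℕ i) ≡ toℕ j → node i T.~ node j
  next-edge eq = Equivalence.from (proj₂ isPath _ _)
    (inj₁ (trans (cong (suc ∘ toℕ) (inverseʳ π)) (trans eq (cong toℕ (sym (inverseʳ π))))))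

  position : Fin N → ℕ
  position t = toℕ (π ⟨$⟩ʳ t)

  position-node : ∀ i → position (node i) ≡ toℕ i
  position-node i = cong toℕ (inverseʳ π)

  -- Induction on the distance `d`. The lower bound on positions shows that the first node does not
  -- recur. The last component, that every node in between is visited, turns coherence into
  -- convexity.
  segment : ∀ d i k → d + toℕ i ≡ toℕ k →
            Σ[ p ∈ Walk T (node i) (node k) ]
              (IsPath T p × All (λ t → toℕ i ≤ position t) (vertices T p) ×
               (∀ j → toℕ i ≤ toℕ j → toℕ j ≤ toℕ k → node j List.∈ vertices T p))
  segment zero i k eq with refl ← Fin.toℕ-injective eq =
    ε , [] ∷ [] , ℕ.≤-reflexive (sym (position-node i)) ∷ [] ,
    λ j i≤j j≤i → here (cong node (Fin.toℕ-injective (ℕ.≤-antisym j≤i i≤j)))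
  segment (suc d) i k eq =
    next-edge (sym toℕ-i′) ◅ p ,
    All.map (λ i′≤t → λ { refl → ℕ.<-irrefl refl
      (subst₂ _≤_ toℕ-i′ (position-node i) i′≤t) }) p≥i′ ∷ p! ,
    ℕ.≤-reflexive (sym (position-node i)) ∷
      All.map (ℕ.≤-trans (ℕ.≤-trans (ℕ.n≤1+n _) (ℕ.≤-reflexive (sym toℕ-i′)))) p≥i′ ,
    contains
    where
    i<k : toℕ i < toℕ k
    i<k = subst (toℕ i <_) eq (s≤s (ℕ.m≤n+m (toℕ i) d))

    i′ : Fin N
    i′ = Fin.fromℕ< (ℕ.≤-<-trans i<k (Fin.toℕ<n k))

    toℕ-i′ : toℕ i′ ≡ suc (toℕ i)
    toℕ-i′ = Fin.toℕ-fromℕ< _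

    rest = segment d i′ k (trans (cong (λ x → d + x) toℕ-i′) (trans (ℕ.+-suc d (toℕ i)) eq))
    p = proj₁ rest
    p! = proj₁ (proj₂ rest)
    p≥i′ = proj₁ (proj₂ (proj₂ rest))

    contains : ∀ j → toℕ i ≤ toℕ j → toℕ j ≤ toℕ k →
               node j List.∈ (node i ∷ vertices T p)
    contains j i≤j j≤k with ℕ.m≤n⇒m<n∨m≡n i≤j
    ... | inj₂ i≡j = here (cong node (sym (Fin.toℕ-injective i≡j)))
    ... | inj₁ i<j = there (proj₂ (proj₂ (proj₂ rest)) j (subst (_≤ _) (sym toℕ-i′) i<j) j≤k)

-- Widths, bag sizes and attained minima.

open TreeDecomposition using (width)

≤foldr-⊔ : ∀ {N} (f : Fin N → ℕ) t → f t ≤ Vector.foldr _⊔_ 0 f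
≤foldr-⊔ f zero    = ℕ.m≤m⊔n _ _
≤foldr-⊔ f (suc t) = ℕ.≤-trans (≤foldr-⊔ (f ∘ suc) t) (ℕ.m≤n⊔m (f zero) _)

foldr-⊔≤ : ∀ {N m} (f : Fin N → ℕ) → (∀ t → f t ≤ m) → Vector.foldr _⊔_ 0 f ≤ m
foldr-⊔≤ {zero}  f f≤ = z≤n
foldr-⊔≤ {suc N} f f≤ = ℕ.⊔-lub (f≤ zero) (foldr-⊔≤ (f ∘ suc) (f≤ ∘ suc))

pred≤⇒≤suc : ∀ m {k} → + m ℤ.- 1ℤ ℤ.≤ + k → m ≤ suc k
pred≤⇒≤suc zero    _            = z≤n
pred≤⇒≤suc (suc m) (ℤ.+≤+ m≤k) = s≤s m≤k

≤suc⇒pred≤ : ∀ m {k} → m ≤ suc k → + m ℤ.- 1ℤ ℤ.≤ + k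
≤suc⇒pred≤ zero    _         = ℤ.-≤+
≤suc⇒pred≤ (suc m) (s≤s m≤k) = ℤ.+≤+ m≤k

module _ {n} {G : Graph n} (D : TreeDecomposition G) where
  open TreeDecomposition D hiding (width)

  maxBag : ℕ
  maxBag = Vector.foldr _⊔_ 0 (λ t → ∣ bag t ∣)

  width≤⇒∣bag∣≤ : ∀ {k} → width D ℤ.≤ + k → ∀ t → ∣ bag t ∣ ≤ suc k
  width≤⇒∣bag∣≤ w≤k t = ℕ.≤-trans (≤foldr-⊔ (λ t → ∣ bag t ∣) t) (pred≤⇒≤suc maxBag w≤k)

  ∣bag∣≤⇒width≤ : ∀ {k} → (∀ t → ∣ bag t ∣ ≤ suc k) → width D ℤ.≤ + k
  ∣bag∣≤⇒width≤ bag≤ = ≤suc⇒pred≤ maxBag (foldr-⊔≤ (λ t → ∣ bag t ∣) bag≤)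

  pathBags : IsPathGraph tree → ∀ {ℓ} → (∀ t → ∣ bag t ∣ ≤ suc ℓ) → PathBags ℓ G ⊤
  pathBags isPath bag≤ = record
    { bags        = tabulate bagAt
    ; chain       = convex⇒chain bagAt convex
    ; small       = All.tabulate⁺ (λ i → bag≤ (node tree isPath i))
    ; within      = All.universal ⊆-max _
    ; coverVertex = λ {u} _ → let t , u∈t = coverVertex u in
        Any.tabulate⁺ (proj₁ isPath ⟨$⟩ʳ t) (subst (λ t → u ∈ bag t) (node-position t) u∈t)
    ; coverEdge   = λ {u} {v} _ _ u~v → let t , uv∈t = coverEdge u~v in
        Any.tabulate⁺ (proj₁ isPath ⟨$⟩ʳ t)
          (subst (λ t → u ∈ bag t × v ∈ bag t) (node-position t) uv∈t)
    }
    where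
    bagAt : Fin order → Subset n
    bagAt i = bag (node tree isPath i)

    node-position : ∀ t → t ≡ node tree isPath (proj₁ isPath ⟨$⟩ʳ t)
    node-position t = sym (inverseˡ (proj₁ isPath))

    convex : ∀ {u i j k} → toℕ i ≤ toℕ j → toℕ j ≤ toℕ k → u ∈ bagAt i → u ∈ bagAt k → u ∈ bagAt j
    convex {i = i} {j} {k} i≤j j≤k u∈i u∈k =
      let p , p! , _ , contains =
            segment tree isPath (toℕ k ∸ toℕ i) i k (ℕ.m∸n+n≡m (ℕ.≤-trans i≤j j≤k))
      in coherent p p! (contains j i≤j j≤k) (x∈p∩q⁺ (u∈i , u∈k))

-- Strong induction on `m`: if `m - 1` satisfies `P` and no smaller value does, it is a minimum; so
-- without a minimum no value satisfies `P`.
attainsMinimum : (P : ℤ → Set₁) → (∀ y → P y → ∃[ m ] y ≡ + m ℤ.- 1ℤ) →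
                 ∀ {y} → P y → ¬ ¬ (∃[ w ] (IsMinimum P w × w ℤ.≤ y))
attainsMinimum P bounded {y} Py noMin = go (proj₁ (bounded y Py)) (proj₂ (bounded y Py)) Py
  where
  none : ∀ {z} → P z → ¬ (∀ x → P x → z ℤ.≤ x)
  none Pz z-min = noMin (_ , (Pz , z-min) , z-min y Py)

  go : ∀ m {z} → z ≡ + m ℤ.- 1ℤ → ¬ P z
  go = <-rec _ λ m smaller → λ { refl Pz → none Pz λ x Px →
    case bounded x Px of λ { (m′ , refl) → case m′ ℕ.<? m of λ
      { (yes m′<m) → contradiction Px (smaller m′<m refl)
      ; (no m′≮m)  → ℤ.+-monoˡ-≤ (ℤ.- 1ℤ) (ℤ.+≤+ (ℕ.≮⇒≥ m′≮m)) } } }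

module _ {n} {G : Graph n} (D : TreeDecomposition G) where
  open TreeDecomposition D hiding (width)

  treewidthAtMost : ∀ {k} → (∀ t → ∣ bag t ∣ ≤ suc k) → ¬ ¬ TreewidthAtMost G k
  treewidthAtMost bag≤ = ¬¬-map
    (λ (w , min , w≤) → w , min , ℤ.≤-trans w≤ (∣bag∣≤⇒width≤ D bag≤))
    (attainsMinimum _ (λ { _ (D , refl) → maxBag D , refl }) (D , refl))

  pathwidthAtMost : IsPathGraph tree → ∀ {ℓ} → (∀ t → ∣ bag t ∣ ≤ suc ℓ) → ¬ ¬ PathwidthAtMost G ℓ
  pathwidthAtMost isPath bag≤ = ¬¬-map
    (λ (w , min , w≤) → w , min , ℤ.≤-trans w≤ (∣bag∣≤⇒width≤ D bag≤))
    (attainsMinimum _ (λ { _ (D , _ , refl) → maxBag D , refl }) (D , isPath , refl))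

pathwidthAtMost⇒pathBags : ∀ {n ℓ} {G : Graph n} → PathwidthAtMost G ℓ → PathBags ℓ G ⊤
pathwidthAtMost⇒pathBags (_ , ((D , isPath , refl) , _) , w≤ℓ) =
  pathBags D isPath (width≤⇒∣bag∣≤ D w≤ℓ)

pathBags⇒pathwidthAtMost : ∀ {n ℓ} {G : Graph n} → PathBags ℓ G ⊤ → ¬ ¬ PathwidthAtMost G ℓ
-- The nodes of `chainTree` are numbered along the path, so the identity permutation shows that the
-- tree is a path graph.
pathBags⇒pathwidthAtMost {n} {ℓ} {G} path = pathwidthAtMost D (Permutation.id , consecutive) bag≤
  where
  open PathBags path
  open ChainTree (chainTree chain)

  D : TreeDecomposition G
  D = record
    { tree = tree ; isTree = isTree ; bag = bag ; coherent = coherent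
    ; coverVertex = λ u →
        let B , B∈ , u∈B = List.find (coverVertex {u} ∈⊤)
            t , t≡B = list-bag B∈
        in t , subst (u ∈_) (sym t≡B) u∈B
    ; coverEdge = λ {u} {v} u~v →
        let B , B∈ , uv∈B = List.find (coverEdge ∈⊤ ∈⊤ u~v)
            t , t≡B = list-bag B∈
        in t , subst (λ B → u ∈ B × v ∈ B) (sym t≡B) uv∈B
    }

  bag≤ : ∀ t → ∣ bag t ∣ ≤ suc ℓ
  bag≤ t with bag-list t
  ... | inj₁ t≡⊥ = subst (λ B → ∣ B ∣ ≤ suc ℓ) (sym t≡⊥)
    (ℕ.≤-trans (ℕ.≤-reflexive (∣⊥∣≡0 n)) z≤n)
  ... | inj₂ t∈  = All.lookup small t∈

-- Restriction and union of path decompositions.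

embedding : ∀ {n} (S : Subset n) → PartialInjection ∣ S ∣ n
embedding S = record
  { _↦_        = λ i u → embed S i ≡ u
  ; _↦?_       = λ i u → embed S i Fin.≟ u
  ; functional = λ { refl refl → refl }
  ; injective  = λ { refl eq → sym (embed-injective S eq) }
  }

induced-pathwidthAtMost : ∀ {n ℓ} {G : Graph n} {S} → PathBags ℓ G S →
                          ¬ ¬ PathwidthAtMost (induced G S) ℓ
induced-pathwidthAtMost {S = S} path = pathBags⇒pathwidthAtMost
  (preimagePath (embedding S) path (λ _ → ∈⊤) (λ {i} _ → embed S i , refl , embed∈ S i)
    λ { refl refl u~v → u~v })

module _ {n} {G : Graph n} {ℓ : ℕ} where
  open Graph G using (_~_)

  pathBags-⊆ : ∀ {S S′} → S′ ⊆ S → PathBags ℓ G S → PathBags ℓ G S′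
  pathBags-⊆ {S} {S′} S′⊆S path = preimagePath restriction path proj₂
    (λ u∈S′ → _ , (refl , u∈S′) , S′⊆S u∈S′) λ { (refl , _) (refl , _) u~v → u~v }
    where
    restriction : PartialInjection n n
    restriction = record
      { _↦_        = λ u v → u ≡ v × u ∈ S′
      ; _↦?_       = λ u v → u Fin.≟ v ×-dec u ∈? S′
      ; functional = λ { (refl , _) (refl , _) → refl }
      ; injective  = λ { (refl , _) (refl , _) → refl }
      }

  -- The two lists are concatenated. By `within` and disjointness no vertex recurs across the seam,
  -- and no edge joins the two sets.
  pathBags-∪ : ∀ {S S′} → (∀ {u} → u ∈ S → u ∉ S′) → (∀ {u v} → u ∈ S → v ∈ S′ → ¬ u ~ v) →
               PathBags ℓ G S → PathBags ℓ G S′ → PathBags ℓ G (S ∪ S′)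
  pathBags-∪ {S} {S′} disjoint separate path path′ = record
    { bags   = P.bags ++ P′.bags
    ; chain  = append P.chain P.within
    ; small  = All.++⁺ P.small P′.small
    ; within = All.++⁺
        (All.map {P = _⊆ S}  (λ B⊆S {_} u∈ → p⊆p∪q S′ (B⊆S u∈)) P.within)
        (All.map {P = _⊆ S′} (λ B⊆S′ {_} u∈ → q⊆p∪q S S′ (B⊆S′ u∈)) P′.within)
    ; coverVertex = λ u∈ → case x∈p∪q⁻ S S′ u∈ of λ
        { (inj₁ u∈S)  → Any.++⁺ˡ (P.coverVertex u∈S)
        ; (inj₂ u∈S′) → Any.++⁺ʳ P.bags (P′.coverVertex u∈S′) }
    ; coverEdge = λ u∈ v∈ u~v → case x∈p∪q⁻ S S′ u∈ , x∈p∪q⁻ S S′ v∈ of λ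
        { (inj₁ u∈S  , inj₁ v∈S)  → Any.++⁺ˡ (P.coverEdge u∈S v∈S u~v)
        ; (inj₁ u∈S  , inj₂ v∈S′) → contradiction u~v (separate u∈S v∈S′)
        ; (inj₂ u∈S′ , inj₁ v∈S)  → contradiction (Graph.sym G u~v) (separate v∈S u∈S′)
        ; (inj₂ u∈S′ , inj₂ v∈S′) → Any.++⁺ʳ P.bags (P′.coverEdge u∈S′ v∈S′ u~v) }
    }
    where
    module P  = PathBags path
    module P′ = PathBags path′

    next-++ : ∀ {u} Bs → Any (u ∈_) Bs → u ∈ nextBag Bs → u ∈ nextBag (Bs ++ P′.bags)
    next-++ (_ ∷ _) _ u∈ = u∈

    append : ∀ {Bs} → Chain Bs → All (_⊆ S) Bs → Chain (Bs ++ P′.bags)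
    append []           []           = P′.chain
    append (_∷_ {Bs = Bs} next c) (B⊆S ∷ Bs⊆S) =
      (λ u∈B u∈ → case Any.++⁻ Bs u∈ of λ
        { (inj₁ u∈Bs) → next-++ Bs u∈Bs (next u∈B u∈Bs)
        ; (inj₂ u∈P′) → let _ , B′∈ , u∈B′ = List.find u∈P′ in
            contradiction (All.lookup P′.within B′∈ u∈B′) (disjoint (B⊆S u∈B)) }) ∷
      append c Bs⊆S

-- Differences, unions and cardinalities of subsets.

x∈p─q⇒x∉q : ∀ {n} (p q : Subset n) {u} → u ∈ p ─ q → u ∉ q
x∈p─q⇒x∉q (_ ∷ p) (_ ∷ q) (there u∈) (there u∈q) = x∈p─q⇒x∉q p q u∈ u∈q
x∈p─q⇒x∉q (inside  ∷ p) (inside ∷ q) () here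
x∈p─q⇒x∉q (outside ∷ p) (inside ∷ q) () here

∣p∣≤∣p─q∣+∣q∣ : ∀ {n} (p q : Subset n) → ∣ p ∣ ≤ ∣ p ─ q ∣ + ∣ q ∣
∣p∣≤∣p─q∣+∣q∣ []            []            = z≤n
∣p∣≤∣p─q∣+∣q∣ (inside  ∷ p) (inside  ∷ q) =
  ℕ.≤-trans (s≤s (∣p∣≤∣p─q∣+∣q∣ p q)) (ℕ.≤-reflexive (sym (ℕ.+-suc _ _)))
∣p∣≤∣p─q∣+∣q∣ (outside ∷ p) (inside  ∷ q) =
  ℕ.≤-trans (∣p∣≤∣p─q∣+∣q∣ p q) (ℕ.+-monoʳ-≤ ∣ p ─ q ∣ (ℕ.n≤1+n _))
∣p∣≤∣p─q∣+∣q∣ (inside  ∷ p) (outside ∷ q) = s≤s (∣p∣≤∣p─q∣+∣q∣ p q)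
∣p∣≤∣p─q∣+∣q∣ (outside ∷ p) (outside ∷ q) = ∣p∣≤∣p─q∣+∣q∣ p q

∣p∣+∣q∣≤∣p∪q∣ : ∀ {n} (p q : Subset n) → (∀ {u} → u ∈ p → u ∉ q) → ∣ p ∣ + ∣ q ∣ ≤ ∣ p ∪ q ∣
∣p∣+∣q∣≤∣p∪q∣ []            []            _   = z≤n
∣p∣+∣q∣≤∣p∪q∣ (inside  ∷ p) (inside  ∷ q) p∌q = contradiction here (p∌q here)
∣p∣+∣q∣≤∣p∪q∣ (outside ∷ p) (inside  ∷ q) p∌q =
  ℕ.≤-trans (ℕ.≤-reflexive (ℕ.+-suc _ _))
    (s≤s (∣p∣+∣q∣≤∣p∪q∣ p q λ u∈ u∈q → p∌q (there u∈) (there u∈q)))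
∣p∣+∣q∣≤∣p∪q∣ (inside  ∷ p) (outside ∷ q) p∌q =
  s≤s (∣p∣+∣q∣≤∣p∪q∣ p q λ u∈ u∈q → p∌q (there u∈) (there u∈q))
∣p∣+∣q∣≤∣p∪q∣ (outside ∷ p) (outside ∷ q) p∌q =
  ∣p∣+∣q∣≤∣p∪q∣ p q λ u∈ u∈q → p∌q (there u∈) (there u∈q)

interpolate : ∀ {n m} (p q : Subset n) → p ⊆ q → ∣ p ∣ ≤ m → m ≤ ∣ q ∣ →
              ∃[ r ] (p ⊆ r × r ⊆ q × ∣ r ∣ ≡ m)
interpolate {m = zero} [] [] p⊆q _ _ = [] , id , id , refl
interpolate (inside ∷ p) (outside ∷ q) p⊆q _ _ with () ← p⊆q here
interpolate {m = suc m} (inside ∷ p) (inside ∷ q) p⊆q (s≤s p≤m) (s≤s m≤q) =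
  let r , p⊆r , r⊆q , eq = interpolate p q (drop-∷-⊆ p⊆q) p≤m m≤q
  in inside ∷ r , s⊆s p⊆r , s⊆s r⊆q , cong suc eq
interpolate (outside ∷ p) (outside ∷ q) p⊆q p≤m m≤q =
  let r , p⊆r , r⊆q , eq = interpolate p q (drop-∷-⊆ p⊆q) p≤m m≤q
  in outside ∷ r , s⊆s p⊆r , s⊆s r⊆q , eq
interpolate {m = m} (outside ∷ p) (inside ∷ q) p⊆q p≤m m≤1+q with m ℕ.≤? ∣ q ∣
... | yes m≤q =
  let r , p⊆r , r⊆q , eq = interpolate p q (out⊆-drop p⊆q) p≤m m≤q
  in outside ∷ r , s⊆s p⊆r , out⊆ r⊆q , eq
  where
  out⊆-drop : outside ∷ p ⊆ inside ∷ q → p ⊆ q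
  out⊆-drop p⊆q u∈ = drop-there (p⊆q (there u∈))
-- Now `m` is one more than `∣ q ∣`, so only the whole larger set has the required size.
... | no m≰q = inside ∷ q , p⊆q , id , ℕ.≤-antisym (ℕ.≰⇒> m≰q) m≤1+q

-- Leaf elimination orders of tree decompositions.

-- A tree decomposition as a list of nodes in which every node but the last is attached to a
-- later one.  With B = X this is the usual running intersection property; in the greedy
-- process B c is larger than X c, but meets other nodes only within X c.
data RunningIntersection {n N} (X B : Fin N → Subset n) : List (Fin N) → Set where
  root   : ∀ {r} → (∀ {u} → u ∉ X r) → RunningIntersection X B (r ∷ [])
  attach : ∀ {c t R} → t List.∈ R → c List.∉ R →
           (∀ {s u} → s List.∈ R → u ∈ B c → u ∈ B s → u ∈ X c × u ∈ X t × u ∈ B t) →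
           RunningIntersection X B R → RunningIntersection X B (c ∷ R)

-- Vertices shared by two new bags must have been shared by the old ones and must survive in every
-- bag; the latter keeps them in the bag of the neighbour `t`. Both greedy steps, deleting `B c` and
-- merging it, have this form.
runningIntersection-map :
  ∀ {n N} {X B B′ : Fin N → Subset n} {R} → RunningIntersection X B R →
  (∀ {c s u} → c List.∈ R → s List.∈ R → c ≢ s → u ∈ B′ c → u ∈ B′ s →
    u ∈ B c × u ∈ B s × (∀ t → u ∈ B t → u ∈ B′ t)) →
  RunningIntersection X B′ R
runningIntersection-map (root ∉X) f = root ∉X
runningIntersection-map (attach t∈R c∉R meet ri) f =
  attach t∈R c∉R
    (λ s∈R u∈c u∈s →
      let u∈c′ , u∈s′ , B⇒B′ = f (here refl) (there s∈R) (λ { refl → c∉R s∈R }) u∈c u∈s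
          u∈Xc , u∈Xt , u∈t  = meet s∈R u∈c′ u∈s′
      in u∈Xc , u∈Xt , B⇒B′ _ u∈t)
    (runningIntersection-map ri λ c∈ s∈ → f (there c∈) (there s∈))

module _ {N} (T : Graph N) where
  private module T = Graph T

  path-suffix : ∀ {Q : Fin N → Set} {u v w} (p : Walk T u v) → w List.∈ vertices T p →
                IsPath T p → All Q (vertices T p) →
                Σ[ q ∈ Walk T w v ] (IsPath T q × All Q (vertices T q))
  path-suffix ε       (here refl) p!       Qp       = ε , p! , Qp
  path-suffix (e ◅ p) (here refl) p!       Qp       = e ◅ p , p! , Qp
  path-suffix (e ◅ p) (there w∈p) (_ ∷ p!) (_ ∷ Qp) = path-suffix p w∈p p! Qp

  AdjacentIn : List (Fin N) → Fin N → Fin N → Set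
  AdjacentIn R s t = s T.~ t × s List.∈ R × t List.∈ R

  -- Loop erasure: if `s` recurs on the path built from its successor, only the part from that
  -- recurrence on is retained.
  path-in : ∀ {R s t} → s List.∈ R → Star (AdjacentIn R) s t →
            Σ[ p ∈ Walk T s t ] (IsPath T p × All (List._∈ R) (vertices T p))
  path-in s∈R ε = ε , [] ∷ [] , s∈R ∷ []
  path-in {s = s} s∈R ((e , _ , t∈R) ◅ w) with path-in t∈R w
  ... | p , p! , p⊆R with Any.any? (s Fin.≟_) (vertices T p)
  ...   | yes s∈p = path-suffix p s∈p p! p⊆R
  ...   | no  s∉p = e ◅ p , All.¬Any⇒All¬ _ s∉p ∷ p! , s∈R ∷ p⊆R

module _ {n} (C : CoherentTree n) where
  open CoherentTree C
  private module T = Graph tree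

  -- Connectedness within `R` itself is carried along because it provides paths that avoid the next
  -- node to be added.
  Grown : List (Fin order) → Set
  Grown R = RunningIntersection bag bag R ×
            (∀ {s t} → s List.∈ R → t List.∈ R → Star (AdjacentIn tree R) s t)

  grow-adjacent : ∀ {R t c} → Grown R → t List.∈ R → c List.∉ R → t T.~ c → Grown (c ∷ R)
  grow-adjacent {R} {t} {c} (ri , connected) t∈R c∉R t~c =
    attach t∈R c∉R meet ri , connected′
    where
    meet : ∀ {s u} → s List.∈ R → u ∈ bag c → u ∈ bag s → u ∈ bag c × u ∈ bag t × u ∈ bag t
    meet {s} {u} s∈R u∈c u∈s = u∈c , u∈t , u∈t
      where
      u∈t : u ∈ bag t
      -- The path from `t` to `s` inside `R` avoids `c`, so prefixing `c` gives a path through `t`,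
      -- to which coherence applies.
      u∈t = let p , p! , p⊆R = path-in tree t∈R (connected t∈R s∈R) in
        coherent (T.sym t~c ◅ p)
          (All.map (λ t∈R → λ { refl → c∉R t∈R }) p⊆R ∷ p!)
          (there (source∈vertices tree p)) (x∈p∩q⁺ (u∈c , u∈s))

    weaken : ∀ {s t} → Star (AdjacentIn tree R) s t → Star (AdjacentIn tree (c ∷ R)) s t
    weaken = Star.map λ (e , s∈ , t∈) → e , there s∈ , there t∈

    connected′ : ∀ {s s′} → s List.∈ (c ∷ R) → s′ List.∈ (c ∷ R) → Star (AdjacentIn tree (c ∷ R)) s s′
    connected′ (here refl) (here refl) = ε
    connected′ (here refl) (there s′∈) = (T.sym t~c , here refl , there t∈R) ◅ weaken (connected t∈R s′∈)
    connected′ (there s∈)  (here refl) = weaken (connected s∈ t∈R) ◅◅ (t~c , there t∈R , here refl) ◅ ε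
    connected′ (there s∈)  (there s′∈) = weaken (connected s∈ s′∈)

  grow-along : ∀ {R s t} → Grown R → s List.∈ R → Walk tree s t →
               ∃[ R′ ] (Grown R′ × (∀ {x} → x List.∈ R → x List.∈ R′) × t List.∈ R′)
  grow-along {R} grown s∈R ε = R , grown , id , s∈R
  grow-along {R} grown s∈R (_◅_ {j = x} e p) with Any.any? (x Fin.≟_) R
  ... | yes x∈R = grow-along grown x∈R p
  ... | no  x∉R =
    let R′ , grown′ , R⊆R′ , t∈R′ = grow-along (grow-adjacent grown s∈R x∉R e) (here refl) p
    in R′ , grown′ , R⊆R′ ∘ there , t∈R′

  grow-through : ∀ {R r} → Grown R → r List.∈ R → (ts : List (Fin order)) →
                 ∃[ R′ ] (Grown R′ × (∀ {x} → x List.∈ R → x List.∈ R′) × All (List._∈ R′) ts)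
  grow-through {R} grown r∈R [] = R , grown , id , []
  grow-through {r = r} grown r∈R (t ∷ ts) =
    let R₁ , grown₁ , R⊆R₁  , t∈R₁  = grow-along grown r∈R (IsTree.connected isTree r t)
        R₂ , grown₂ , R₁⊆R₂ , ts⊆R₂ = grow-through grown₁ (R⊆R₁ r∈R) ts
    in R₂ , grown₂ , R₁⊆R₂ ∘ R⊆R₁ , R₁⊆R₂ t∈R₁ ∷ ts⊆R₂

  -- The list starts as `r` alone and grows at its front along walks to all nodes in turn, so `r`
  -- remains the root.
  runningIntersection : ∀ {r} → (∀ {u} → u ∉ bag r) →
                        ∃[ R ] (RunningIntersection bag bag R × (∀ t → t List.∈ R))
  runningIntersection {r} ∉r =
    let R , (ri , _) , _ , all∈R = grow-through single (here refl) (allFin order)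
    in R , ri , λ t → All.lookup all∈R (∈-allFin t)
    where
    single : Grown (r ∷ [])
    single = root ∉r , λ { (here refl) (here refl) → ε }

-- The greedy process.

-- U is the set of vertices that are neither kept nor deleted so far.
record State {n N} (G : Graph n) (Good : Subset n → Set) (X : Fin N → Subset n)
             (R : List (Fin N)) (U : Subset n) (B : Fin N → Subset n) : Set where
  open Graph G using (_~_)
  field
    ri          : RunningIntersection X B R
    coverVertex : ∀ {u} → u ∈ U → Any (λ s → u ∈ B s) R
    coverEdge   : ∀ {u v} → u ∈ U → v ∈ U → u ~ v → Any (λ s → u ∈ B s × v ∈ B s) R
    B⊆U         : ∀ s → B s ⊆ U
    good        : ∀ s → Good (B s ─ X s)

module _ {n N k M : ℕ} (G : Graph n) (Good : Subset n → Set) (X : Fin N → Subset n)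
         (good-⊆ : ∀ {S S′} → S′ ⊆ S → Good S → Good S′)
         (good-∪ : ∀ {S S′} → (∀ {u} → u ∈ S → u ∉ S′) →
                   (∀ {u v} → u ∈ S → v ∈ S′ → ¬ Graph._~_ G u v) →
                   Good S → Good S′ → Good (S ∪ S′))
         (good-small : ∀ {S} → ∣ S ∣ ≤ M → Good S)
         (∣X∣≤ : ∀ t → ∣ X t ∣ ≤ suc k)
         where
  open Graph G using (_~_)

  -- The inequality says that `K` makes up at least the fraction M / (M + k + 1) of `U`, with the
  -- denominator cleared.
  LargeGood : Subset n → Set
  LargeGood U = ∃[ K ] (K ⊆ U × Good K × M * ∣ U ∣ ≤ (M + suc k) * ∣ K ∣)

  -- Used with `B c` for `B`, `X c` for `C` and `X c ∩ X t` for `A`. `W` may take in part of `C` to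
  -- reach size `M`, but avoids `A`, where `B` meets the remaining bags.
  Cut : (A B C : Subset n) → Set
  Cut A B C = ∃[ W ] (B ─ C ⊆ W × W ⊆ B ─ A × M ≤ ∣ W ∣ × Good W)

  ─-antitone : ∀ {A C} (B : Subset n) → A ⊆ C → B ─ C ⊆ B ─ A
  ─-antitone {C = C} B A⊆C u∈ = x∈p∧x∉q⇒x∈p─q (p─q⊆p B C u∈) (x∈p─q⇒x∉q B C u∈ ∘ A⊆C)

  -- If `B ─ C` has at least `M` elements, it serves as `W`. Otherwise it is enlarged inside `B ─ A`
  -- to exactly `M` elements, and the result is good by size alone.
  cutOrSmall : ∀ A B C → A ⊆ C → Good (B ─ C) → Cut A B C ⊎ ∣ B ─ A ∣ ≤ M
  cutOrSmall A B C A⊆C good with M ℕ.≤? ∣ B ─ C ∣ | M ℕ.≤? ∣ B ─ A ∣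
  ... | _      | no M≰A  = inj₂ (ℕ.<⇒≤ (ℕ.≰⇒> M≰A))
  ... | yes M≤ | yes _   = inj₁ (B ─ C , id , ─-antitone B A⊆C , M≤ , good)
  ... | no M≰  | yes M≤A =
    let W , ⊆W , W⊆ , ∣W∣≡M = interpolate (B ─ C) (B ─ A) (─-antitone B A⊆C) (ℕ.<⇒≤ (ℕ.≰⇒> M≰)) M≤A
    in inj₁ (W , ⊆W , W⊆ , ℕ.≤-reflexive (sym ∣W∣≡M) , good-small (ℕ.≤-reflexive ∣W∣≡M))

  module _ {c t R U B} (t∈R : t List.∈ R) (c∉R : c List.∉ R)
           (meet : ∀ {s u} → s List.∈ R → u ∈ B c → u ∈ B s → u ∈ X c × u ∈ X t × u ∈ B t)
           (ri : RunningIntersection X B R) (state : State G Good X (c ∷ R) U B) where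
    private module S = State state

    -- A vertex or edge of `U ─ B c` cannot be covered by the bag of `c`, hence is covered within
    -- `R`. The sets `B s ─ X s` only shrink and stay good.
    cutState : State G Good X R (U ─ B c) (λ s → B s ─ B c)
    cutState = record
      { ri          = runningIntersection-map ri λ {a} {s} a∈R s∈R _ u∈a u∈s →
          p─q⊆p (B a) (B c) u∈a , p─q⊆p (B s) (B c) u∈s ,
          λ r u∈r → x∈p∧x∉q⇒x∈p─q u∈r (x∈p─q⇒x∉q (B a) (B c) u∈a)
      ; coverVertex = λ u∈ → let u∉c = x∈p─q⇒x∉q U (B c) u∈ in
          Any.map (λ u∈s → x∈p∧x∉q⇒x∈p─q u∈s u∉c)
            (Any.tail u∉c (S.coverVertex (p─q⊆p U (B c) u∈)))
      ; coverEdge   = λ u∈ v∈ u~v → let u∉c = x∈p─q⇒x∉q U (B c) u∈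
                                        v∉c = x∈p─q⇒x∉q U (B c) v∈ in
          Any.map (λ (u∈s , v∈s) → x∈p∧x∉q⇒x∈p─q u∈s u∉c , x∈p∧x∉q⇒x∈p─q v∈s v∉c)
            (Any.tail (u∉c ∘ proj₁) (S.coverEdge (p─q⊆p U (B c) u∈) (p─q⊆p U (B c) v∈) u~v))
      ; B⊆U         = λ s u∈ → x∈p∧x∉q⇒x∈p─q (S.B⊆U s (p─q⊆p (B s) (B c) u∈))
                                              (x∈p─q⇒x∉q (B s) (B c) u∈)
      ; good        = λ s → good-⊆
          (λ u∈ → x∈p∧x∉q⇒x∈p─q (p─q⊆p (B s) (B c) (p─q⊆p (B s ─ B c) (X s) u∈))
                                 (x∈p─q⇒x∉q (B s ─ B c) (X s) u∈))
          (S.good s)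
      }

    -- At most `suc k` vertices are deleted while `w` are kept; `M * suc k ≤ w * suc k` charges the
    -- deleted vertices to the kept ones.
    cutCount : ∀ {u u′ w k′} → u ≤ u′ + (suc k + w) → M ≤ w →
               M * u′ ≤ (M + suc k) * k′ → M * u ≤ (M + suc k) * (k′ + w)
    cutCount {u} {u′} {w} {k′} u≤ M≤w ih = begin
      M * u                              ≤⟨ ℕ.*-monoʳ-≤ M u≤ ⟩
      M * (u′ + (suc k + w))             ≡⟨ expand M u′ (suc k) w ⟩
      M * u′ + (M * w + M * suc k)       ≤⟨ ℕ.+-mono-≤ ih (ℕ.+-monoʳ-≤ (M * w) (ℕ.*-monoˡ-≤ (suc k) M≤w)) ⟩
      (M + suc k) * k′ + (M * w + w * suc k) ≡⟨ collect M (suc k) k′ w ⟩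
      (M + suc k) * (k′ + w)             ∎
      where
      open ℕ.≤-Reasoning
      expand : ∀ M u k w → M * (u + (k + w)) ≡ M * u + (M * w + M * k)
      expand = solve-∀
      collect : ∀ M k k′ w → (M + k) * k′ + (M * w + w * k) ≡ (M + k) * (k′ + w)
      collect = solve-∀

    cut : Cut (X c ∩ X t) (B c) (X c) → LargeGood (U ─ B c) → LargeGood U
    cut (W , ⊆W , W⊆ , M≤W , goodW) (K , K⊆ , goodK , large) =
      K ∪ W , K∪W⊆U , good-∪ disjoint separate goodK goodW ,
      ℕ.≤-trans (cutCount ∣U∣≤ M≤W large)
        (ℕ.*-monoʳ-≤ (M + suc k) (∣p∣+∣q∣≤∣p∪q∣ K W disjoint))
      where
      W⊆Bc : W ⊆ B c
      W⊆Bc = p─q⊆p (B c) (X c ∩ X t) ∘ W⊆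

      K∌Bc : ∀ {u} → u ∈ K → u ∉ B c
      K∌Bc = x∈p─q⇒x∉q U (B c) ∘ K⊆

      disjoint : ∀ {u} → u ∈ K → u ∉ W
      disjoint u∈K u∈W = K∌Bc u∈K (W⊆Bc u∈W)

      K∪W⊆U : K ∪ W ⊆ U
      K∪W⊆U u∈ = [ p─q⊆p U (B c) ∘ K⊆ , S.B⊆U c ∘ W⊆Bc ]′ (x∈p∪q⁻ K W u∈)

      separate : ∀ {u v} → u ∈ K → v ∈ W → ¬ u ~ v
      -- Some bag contains the edge. It is not `B c`, which `u` avoids; in any other bag `v` would
      -- lie in `X c ∩ X t`, which `W` avoids.
      separate u∈K v∈W u~v
        with S.coverEdge (p─q⊆p U (B c) (K⊆ u∈K)) (S.B⊆U c (W⊆Bc v∈W)) u~v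
      ... | here (u∈c , _) = K∌Bc u∈K u∈c
      ... | there uv∈R with s , s∈R , _ , v∈s ← List.find uv∈R =
        let v∈Xc , v∈Xt , _ = meet s∈R (W⊆Bc v∈W) v∈s
        in x∈p─q⇒x∉q (B c) (X c ∩ X t) (W⊆ v∈W) (x∈p∩q⁺ (v∈Xc , v∈Xt))

      Bc─W⊆Xc : B c ─ W ⊆ X c
      Bc─W⊆Xc {u} u∈ with u ∈? X c
      ... | yes u∈Xc = u∈Xc
      ... | no  u∉Xc = contradiction (⊆W (x∈p∧x∉q⇒x∈p─q (p─q⊆p (B c) W u∈) u∉Xc))
                                     (x∈p─q⇒x∉q (B c) W u∈)

      ∣U∣≤ : ∣ U ∣ ≤ ∣ U ─ B c ∣ + (suc k + ∣ W ∣)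
      -- `U` splits into `U ─ B c`, the kept `W` and the deleted `B c ─ W`, which lies in `X c`.
      ∣U∣≤ = ℕ.≤-trans (∣p∣≤∣p─q∣+∣q∣ U (B c)) (ℕ.+-monoʳ-≤ ∣ U ─ B c ∣
        (ℕ.≤-trans (∣p∣≤∣p─q∣+∣q∣ (B c) W) (ℕ.+-monoˡ-≤ ∣ W ∣
          (ℕ.≤-trans (p⊆q⇒∣p∣≤∣q∣ Bc─W⊆Xc) (∣X∣≤ c)))))

    mergedBag : Fin N → Subset n
    mergedBag s with s Fin.≟ t
    ... | yes _ = B s ∪ B c
    ... | no  _ = B s

    B⊆mergedBag : ∀ s → B s ⊆ mergedBag s
    B⊆mergedBag s u∈ with s Fin.≟ t
    ... | yes _ = p⊆p∪q (B c) u∈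
    ... | no  _ = u∈

    Bc⊆mergedBag : B c ⊆ mergedBag t
    Bc⊆mergedBag u∈ with t Fin.≟ t
    ... | yes _   = q⊆p∪q (B t) (B c) u∈
    ... | no  t≢t = contradiction refl t≢t

    ∈-mergedBag⁻ : ∀ s {u} → u ∈ mergedBag s → u ∈ B s ⊎ (s ≡ t × u ∈ B c)
    ∈-mergedBag⁻ s u∈ with s Fin.≟ t
    ... | yes s≡t = Sum.map₂ (s≡t ,_) (x∈p∪q⁻ (B s) (B c) u∈)
    ... | no  _   = inj₁ u∈

    mergeState : ∣ B c ─ (X c ∩ X t) ∣ ≤ M → State G Good X R U mergedBag
    mergeState small = record
      { ri          = runningIntersection-map ri λ a∈R s∈R a≢s u∈a u∈s →
          let u∈Ba , u∈Bs = separated a∈R s∈R a≢s u∈a u∈s in u∈Ba , u∈Bs , λ r → B⊆mergedBag r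
      ; coverVertex = λ u∈U → case S.coverVertex u∈U of λ
          { (here u∈c)  → List.lose t∈R (Bc⊆mergedBag u∈c)
          ; (there u∈R) → Any.map (B⊆mergedBag _) u∈R }
      ; coverEdge   = λ u∈U v∈U u~v → case S.coverEdge u∈U v∈U u~v of λ
          { (here (u∈c , v∈c)) → List.lose t∈R (Bc⊆mergedBag u∈c , Bc⊆mergedBag v∈c)
          ; (there uv∈R)       → Any.map (Product.map (B⊆mergedBag _) (B⊆mergedBag _)) uv∈R }
      ; B⊆U         = λ s u∈ → [ S.B⊆U s , S.B⊆U c ∘ proj₂ ]′ (∈-mergedBag⁻ s u∈)
      ; good        = good′
      }
      where
      separated : ∀ {a s u} → a List.∈ R → s List.∈ R → a ≢ s →
                  u ∈ mergedBag a → u ∈ mergedBag s → u ∈ B a × u ∈ B s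
      -- By `meet`, a vertex of `B c` that occurs in a remaining bag is already in `B t`, so the
      -- merge creates no new intersections.
      separated {a} {s} a∈R s∈R a≢s u∈a u∈s with ∈-mergedBag⁻ a u∈a | ∈-mergedBag⁻ s u∈s
      ... | inj₁ u∈Ba         | inj₁ u∈Bs         = u∈Ba , u∈Bs
      ... | inj₁ u∈Ba         | inj₂ (refl , u∈c) = u∈Ba , proj₂ (proj₂ (meet a∈R u∈c u∈Ba))
      ... | inj₂ (refl , u∈c) | inj₁ u∈Bs         = proj₂ (proj₂ (meet s∈R u∈c u∈Bs)) , u∈Bs
      ... | inj₂ (refl , _)   | inj₂ (refl , _)   = contradiction refl a≢s

      disjoint : ∀ {u} → u ∈ B t ─ X t → u ∉ B c ─ X t
      disjoint u∈t u∈c = x∈p─q⇒x∉q (B t) (X t) u∈t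
        (proj₁ (proj₂ (meet t∈R (p─q⊆p (B c) (X t) u∈c) (p─q⊆p (B t) (X t) u∈t))))

      separate : ∀ {u v} → u ∈ B t ─ X t → v ∈ B c ─ X t → ¬ u ~ v
      separate u∈ v∈ u~v
        with u∈t ← p─q⊆p (B t) (X t) u∈ | v∈c ← p─q⊆p (B c) (X t) v∈
        with S.coverEdge (S.B⊆U t u∈t) (S.B⊆U c v∈c) u~v
      ... | here (u∈c , _) = x∈p─q⇒x∉q (B t) (X t) u∈ (proj₁ (proj₂ (meet t∈R u∈c u∈t)))
      ... | there uv∈R with s , s∈R , _ , v∈s ← List.find uv∈R =
        x∈p─q⇒x∉q (B c) (X t) v∈ (proj₁ (proj₂ (meet s∈R v∈c v∈s)))

      good-Bc : Good (B c ─ X t)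
      -- `X t` contains `X c ∩ X t`, so `B c ─ X t` inherits the bound `M`.
      good-Bc = good-small (ℕ.≤-trans
        (p⊆q⇒∣p∣≤∣q∣ (─-antitone (B c) (p∩q⊆q (X c) (X t)))) small)

      good′ : ∀ s → Good (mergedBag s ─ X s)
      good′ s with s Fin.≟ t
      ... | no  _    = S.good s
      ... | yes refl = good-⊆
        (λ u∈ → x∈p∪q⁺ (Sum.map (λ u∈t → x∈p∧x∉q⇒x∈p─q u∈t (u∉X u∈))
                                 (λ u∈c → x∈p∧x∉q⇒x∈p─q u∈c (u∉X u∈))
                         (x∈p∪q⁻ (B t) (B c) (p─q⊆p (B t ∪ B c) (X t) u∈))))
        (good-∪ disjoint separate (S.good t) good-Bc)
        where
        u∉X : ∀ {u} → u ∈ (B t ∪ B c) ─ X t → u ∉ X t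
        u∉X = x∈p─q⇒x∉q (B t ∪ B c) (X t)

  largeGood : ∀ R {U B} → State G Good X R U B → LargeGood U
  largeGood R {U} {B} state with State.ri state
  -- `X r` is empty, so `U` lies in the good set `B r ─ X r` and is kept whole.
  ... | root {r} ∉X = U , id , good-⊆ U⊆ (good r) , ℕ.*-monoˡ-≤ ∣ U ∣ (ℕ.m≤m+n M (suc k))
    where
    open State state
    U⊆ : U ⊆ B r ─ X r
    U⊆ u∈U with here u∈r ← coverVertex u∈U = x∈p∧x∉q⇒x∈p─q u∈r ∉X
  ... | attach {c} {t} {R′} t∈R c∉R meet ri
    with cutOrSmall (X c ∩ X t) (B c) (X c) (p∩q⊆p (X c) (X t)) (State.good state c)
  ...   | inj₁ W     = cut t∈R c∉R meet ri state W (largeGood R′ (cutState t∈R c∉R meet ri state))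
  ...   | inj₂ small = largeGood R′ (mergeState t∈R c∉R meet ri state small)

-- Padding small induced subgraphs to order `M`.

someNode : ∀ {n} (C : CoherentTree n) → Fin (CoherentTree.order C)
someNode C = Fin.fromℕ< {0} (ℕ.>-nonZero⁻¹ order {{IsTree.nonEmpty isTree}})
  where open CoherentTree C

coherentTree : ∀ {n} {G : Graph n} → TreeDecomposition G → CoherentTree n
coherentTree D = record { tree = tree ; isTree = isTree ; bag = bag ; coherent = coherent }
  where open TreeDecomposition D

-- By `keeps` every old bag survives, so edges covered before remain covered.
record Extension {n} (k : ℕ) (C : CoherentTree n) (vs : List (Fin n)) : Set₁ where
  open CoherentTree
  field
    tree′  : CoherentTree n
    bag≤   : ∀ t → ∣ bag tree′ t ∣ ≤ suc k
    keeps  : ∀ t → ∃[ t′ ] bag tree′ t′ ≡ bag C t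
    covers : All (λ v → ∃[ t ] v ∈ bag tree′ t) vs

-- Isolated vertices of a padded graph occur in no bag, so each gets a new leaf of its own.
coverVertices : ∀ {n k} (C : CoherentTree n) → (∀ t → ∣ CoherentTree.bag C t ∣ ≤ suc k) →
                ∀ vs → Extension k C vs
coverVertices C bag≤ [] = record { tree′ = C ; bag≤ = bag≤ ; keeps = λ t → t , refl ; covers = [] }
coverVertices {n} {k} C bag≤ (v ∷ vs) = extend (Fin.any? λ t → v ∈? bag t)
  where
  open Extension (coverVertices C bag≤ vs) renaming (bag≤ to bag′≤)
  open CoherentTree tree′

  extend : Dec (∃[ t ] v ∈ bag t) → Extension k C (v ∷ vs)
  extend (yes v∈) = record { tree′ = tree′ ; bag≤ = bag′≤ ; keeps = keeps ; covers = v∈ ∷ covers }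
  extend (no  v∉) = record
    { tree′  = addBag tree′ (someNode tree′) ⁅ v ⁆ meet
    ; bag≤   = λ { zero → ℕ.≤-trans (ℕ.≤-reflexive (∣⁅x⁆∣≡1 v)) (s≤s z≤n) ; (suc t) → bag′≤ t }
    ; keeps  = λ t → Product.map suc id (keeps t)
    ; covers = (zero , x∈⁅x⁆ v) ∷ All.map (Product.map suc id) covers
    }
    where
    meet : ∀ s → ⁅ v ⁆ ∩ bag s ⊆ bag (someNode tree′)
    meet s {u} u∈ with u∈v , u∈s ← x∈p∩q⁻ ⁅ v ⁆ (bag s) u∈ with refl ← x∈⁅y⁆⇒x≡y v u∈v =
      contradiction (s , u∈s) v∉

module _ {n m} (G : Graph n) (σ : PartialInjection m n) where
  open Graph G using (_~_; _~?_)
  open PartialInjection σ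

  -- Elements of `Fin m` related to no vertex of `G` become isolated; they are the padding.
  pullback : Graph m
  pullback = record
    { _~_    = λ i j → ∃[ u ] ∃[ v ] (i ↦ u × j ↦ v × u ~ v)
    ; sym    = λ (u , v , i↦u , j↦v , u~v) → v , u , j↦v , i↦u , Graph.sym G u~v
    ; irrefl = λ { refl (u , v , i↦u , i↦v , u~v) → Graph.irrefl G (functional i↦u i↦v) u~v }
    ; _~?_   = λ i j → Fin.any? λ u → Fin.any? λ v → i ↦? u ×-dec j ↦? v ×-dec u ~? v
    }

  pullback-treewidthAtMost : ∀ {k} (D : TreeDecomposition G) →
                             (∀ t → ∣ TreeDecomposition.bag D t ∣ ≤ suc k) →
                             ¬ ¬ TreewidthAtMost pullback k
  pullback-treewidthAtMost D bag≤ = treewidthAtMost D′ (Extension.bag≤ extension)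
    where
    module D = TreeDecomposition D

    C : CoherentTree m
    C = preimageTree (coherentTree D)

    extension = coverVertices C (λ t → ℕ.≤-trans (∣preimage∣≤ (D.bag t)) (bag≤ t)) (allFin m)
    open Extension extension using (tree′; keeps; covers)
    open CoherentTree tree′

    D′ : TreeDecomposition pullback
    D′ = record
      { tree = tree ; isTree = isTree ; bag = bag ; coherent = coherent
      ; coverVertex = λ i → All.lookup covers (∈-allFin i)
      ; coverEdge   = λ {i} {j} (u , v , i↦u , j↦v , u~v) →
          let t , u∈t , v∈t = D.coverEdge u~v
              t′ , t′≡t     = keeps t
          in t′ , subst (λ B → i ∈ B × j ∈ B) (sym t′≡t)
                    (∈-preimage⁺ i↦u u∈t , ∈-preimage⁺ j↦v v∈t)
      }

-- The vertices of S become the first ∣ S ∣ of m vertices.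
initialEmbedding : ∀ {n m} (S : Subset n) → ∣ S ∣ ≤ m → PartialInjection m n
initialEmbedding {n} {m} S S≤m = record
  { _↦_        = λ i u → ∃[ j ] (Fin.inject≤ j S≤m ≡ i × embed S j ≡ u)
  ; _↦?_       = λ i u → Fin.any? λ j → Fin.inject≤ j S≤m Fin.≟ i ×-dec embed S j Fin.≟ u
  ; functional = λ { (j , refl , refl) (j′ , eq , refl) →
                     cong (embed S) (sym (Fin.inject≤-injective S≤m S≤m j′ j eq)) }
  ; injective  = λ { (j , refl , refl) (j′ , refl , eq) →
                     cong (λ j → Fin.inject≤ j S≤m) (sym (embed-injective S eq)) }
  }

-- The hypothesis concerns graphs of order exactly `M`, so the subgraph induced by `S` is padded
-- with isolated vertices. Treewidth stays at most `k`, and the path decomposition obtained is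
-- pulled back along `flip σ`.
small⇒pathBags : ∀ {n k ℓ M} {G : Graph n} (D : TreeDecomposition G) →
                 (∀ t → ∣ TreeDecomposition.bag D t ∣ ≤ suc k) →
                 ((H : Graph M) → TreewidthAtMost H k → PathwidthAtMost H ℓ) →
                 ∀ {S} → ∣ S ∣ ≤ M → ¬ ¬ PathBags ℓ G S
small⇒pathBags {G = G} D bag≤ tw⇒pw {S} S≤M = ¬¬-map
  (λ tw → preimagePath (flip σ) (pathwidthAtMost⇒pathBags (tw⇒pw (pullback G σ) tw))
    (λ { (j , _ , refl) → embed∈ S j })
    (λ u∈S → let j , j↦u = embed-surjective S u∈S in _ , (j , refl , j↦u) , ∈⊤)
    (λ i↦u j↦v u~v → _ , _ , i↦u , j↦v , u~v))
  (pullback-treewidthAtMost G σ D bag≤)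
  where
  σ = initialEmbedding S S≤M

-- The bound for `G` and its rational form.

large-pathwidthAtMost :
  ∀ {n k ℓ M} {G : Graph n} (D : TreeDecomposition G) →
  (∀ t → ∣ TreeDecomposition.bag D t ∣ ≤ suc k) →
  ((H : Graph M) → TreewidthAtMost H k → PathwidthAtMost H ℓ) →
  ∃[ K ] (¬ ¬ PathwidthAtMost (induced G K) ℓ × M * n ≤ (M + suc k) * ∣ K ∣)
large-pathwidthAtMost {n} {k} {ℓ} {M} {G} D bag≤ tw⇒pw =
  let R , ri , all∈R = runningIntersection rooted {zero} ∉⊥
      K , _ , good , large = largeGood G Good bag good-⊆ good-∪ good-small bag′≤ R (initial ri all∈R)
  in K , (λ ¬pw → good λ path → induced-pathwidthAtMost path ¬pw) ,
     subst (λ x → M * x ≤ (M + suc k) * ∣ K ∣) (∣⊤∣≡n n) large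
  where
  -- The root needs an empty bag: what remains there at the end of the process is kept.
  rooted : CoherentTree n
  rooted = addBag (coherentTree D) (someNode (coherentTree D)) ⊥
    λ s u∈ → contradiction (proj₁ (x∈p∩q⁻ ⊥ (TreeDecomposition.bag D s) u∈)) ∉⊥
  open CoherentTree rooted

  bag′≤ : ∀ t → ∣ bag t ∣ ≤ suc k
  bag′≤ zero    = ℕ.≤-trans (ℕ.≤-reflexive (∣⊥∣≡0 n)) z≤n
  bag′≤ (suc t) = bag≤ t

  Good : Subset n → Set
  Good S = ¬ ¬ PathBags ℓ G S

  good-⊆ : ∀ {S S′} → S′ ⊆ S → Good S → Good S′
  good-⊆ S′⊆S = ¬¬-map (pathBags-⊆ S′⊆S)

  good-∪ : ∀ {S S′} → (∀ {u} → u ∈ S → u ∉ S′) → (∀ {u v} → u ∈ S → v ∈ S′ → ¬ Graph._~_ G u v) →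
           Good S → Good S′ → Good (S ∪ S′)
  good-∪ disjoint separate good good′ ¬path =
    good λ path → good′ λ path′ → ¬path (pathBags-∪ disjoint separate path path′)

  good-small : ∀ {S} → ∣ S ∣ ≤ M → Good S
  good-small = small⇒pathBags D bag≤ tw⇒pw

  initial : ∀ {R} → RunningIntersection bag bag R → (∀ t → t List.∈ R) →
            State G Good bag R ⊤ bag
  initial ri all∈R = record
    { ri          = ri
    ; coverVertex = λ {u} _ →
        let t , u∈t = TreeDecomposition.coverVertex D u in List.lose (all∈R (suc t)) u∈t
    ; coverEdge   = λ _ _ u~v →
        let t , uv∈t = TreeDecomposition.coverEdge D u~v in List.lose (all∈R (suc t)) uv∈t
    ; B⊆U         = λ _ → ⊆-max _
    -- At the start `B` and `X` coincide, so the difference is empty.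
    ; good        = λ t → good-small
        (ℕ.≤-trans (p⊆q⇒∣p∣≤∣q∣ {q = ⊥} λ u∈ →
          contradiction (p─q⊆p (bag t) (bag t) u∈) (x∈p─q⇒x∉q (bag t) (bag t) u∈))
          (ℕ.≤-trans (ℕ.≤-reflexive (∣⊥∣≡0 n)) z≤n))
    }

fraction-≤ : ∀ m d n i → m * n ≤ suc d * i → (+ m / suc d) ℚ.* (+ n / 1) ℚ.≤ + i / 1
fraction-≤ m d n i mn≤di = ℚ.toℚᵘ-cancel-≤ (begin
  toℚᵘ ((+ m / suc d) ℚ.* (+ n / 1))       ≃⟨ ℚ.toℚᵘ-homo-* (+ m / suc d) (+ n / 1) ⟩
  toℚᵘ (+ m / suc d) ℚᵘ.* toℚᵘ (+ n / 1)   ≃⟨ ℚᵘ.*-cong (ℚ.toℚᵘ-fromℚᵘ (mkℚᵘ (+ m) d))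
                                                         (ℚ.toℚᵘ-fromℚᵘ (mkℚᵘ (+ n) 0)) ⟩
  mkℚᵘ (+ m) d ℚᵘ.* mkℚᵘ (+ n) 0           ≤⟨ ℚᵘ.*≤* cross ⟩
  mkℚᵘ (+ i) 0                             ≃⟨ ℚ.toℚᵘ-fromℚᵘ (mkℚᵘ (+ i) 0) ⟨
  toℚᵘ (+ i / 1)                           ∎)
  where
  open ℚᵘ.≤-Reasoning
  -- The order on unnormalised fractions is cross-multiplication; the product on the left has
  -- denominator `suc d * 1`.
  cross : (+ m ℤ.* + n) ℤ.* + 1 ℤ.≤ + i ℤ.* (+ (suc d * 1))
  cross = subst₂ ℤ._≤_
    (trans (ℤ.pos-* m n) (sym (ℤ.*-identityʳ (+ m ℤ.* + n))))
    (trans (ℤ.pos-* i (suc d)) (cong (λ x → + i ℤ.* + x) (sym (ℕ.*-identityʳ (suc d)))))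
    (ℤ.+≤+ (subst (m * n ≤_) (ℕ.*-comm (suc d) i) mn≤di))

proposition3 : (k ℓ : ℕ) .{{_ : NonZero k}} .{{_ : NonZero ℓ}} →
    (n : ℕ) (G : Graph n) → TreewidthAtMost G k →
    (M : ℕ) → IsM k ℓ M →
    (I : ℕ) → IsI ℓ G I →
    (+ M / suc (M + k)) ℚ.* (+ n / 1) ℚ.≤ + I / 1
proposition3 k ℓ n G (_ , ((D , refl) , _) , tw≤k) M (tw⇒pw , _) I (_ , I-max) =
  let K , pw , large = large-pathwidthAtMost D (width≤⇒∣bag∣≤ D tw≤k) tw⇒pw
      ∣K∣≤I : ∣ K ∣ ≤ I
      ∣K∣≤I = decidable-stable (∣ K ∣ ℕ.≤? I) (¬¬-map (λ pw → I-max ∣ K ∣ (K , refl , pw)) pw)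
  in fraction-≤ M (M + k) n I (begin
       M * n                ≤⟨ large ⟩
       (M + suc k) * ∣ K ∣  ≤⟨ ℕ.*-monoʳ-≤ (M + suc k) ∣K∣≤I ⟩
       (M + suc k) * I      ≡⟨ cong (_* I) (ℕ.+-suc M k) ⟩
       suc (M + k) * I      ∎)
  where open ℕ.≤-Reasoning
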